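{- Let $(\mathbf A_n)_{n\in\mathbb N}$ be an elementarily convergent sequence of base structures and $(\mathbf G_n)_{n\in\mathbb N}$ an elementarily convergent sequence of gadgets. Then the sequence $(\mathbf A_n*\mathbf G_n)_{n\in\mathbb N}$ is elementarily convergent, and \[ \operatorname{el-lim}(\mathbf A_n*\mathbf G_n)\equiv(\operatorname{el-lim}\mathbf A_n)*(\operatorname{el-lim}\mathbf G_n), \] where $\operatorname{el-lim}$ denotes any choice of an elementary limit of the respective sequence and $\equiv$ denotes elementary equivalence.
   Context: Fix a purely relational first-order language $L$ (with equality, all arities finite and positive) and a relation symbol $R\notin L$ of arity $\mathrm{ar}(R)\ge 1$. Structures are nonempty and of arbitrary cardinality; $V(\mathbf A)$ is the universe of $\mathbf A$. Base structures and gadgets. $L_R=L\cup\{R\}$; a base structure is an $L_R$-structure. $L_G$ is $L$ extended by constants $z_1,\dots,z_{\mathrm{ar}(R)}$; a gadget is an $L_G$-structure $\mathbf G$ in which the vertices $z_i^{\mathbf G}$ (the roots) are pairwise distinct. Gadget construction. For a base structure $\mathbf A$ and a gadget $\mathbf G$, $\mathbf A*\mathbf G$ is the $L$-structure with universe $\big(V(\mathbf A)\sqcup(R^{\mathbf A}\times V(\mathbf G))\big)/\!\sim$, where $\sim$ is the equivalence generated by $e_i\sim(\boldsymbol e,z_i^{\mathbf G})$ for $\boldsymbol e\in R^{\mathbf A}$, $i\in\{1,\dots,\mathrm{ar}(R)\}$. For $S\in L$ of arity $s$, $S^{\mathbf A*\mathbf G}=\{([a_1],\dots,[a_s]):(a_1,\dots,a_s)\in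 S^{\mathbf A}\}\cup\{([(\boldsymbol e,v_1)],\dots,[(\boldsymbol e,v_s)]):\boldsymbol e\in R^{\mathbf A},(v_1,\dots,v_s)\in S^{\mathbf G}\}$. Elementary convergence. A sequence of structures in a fixed language is elementarily convergent if for every sentence $\phi$ either all but finitely many members satisfy $\phi$, or all but finitely many satisfy $\neg\phi$. An elementary limit of such a sequence is any structure $\mathbf M$ (of arbitrary cardinality) in the same language such that $\mathbf M\models\phi$ iff all but finitely many members of the sequence satisfy $\phi$, for every sentence $\phi$; it exists and is unique up to elementary equivalence. -}

module Defs where

open import Data.Empty using (⊥)
open import Data.Fin.Base using (Fin)
open import Data.Nat.Base using (ℕ; suc; _≤_; NonZero)
open import Data.Nat.Properties using (≤-refl)
open import Data.Product.Base using (Σ-syntax; ∃-syntax; _×_; _,_; proj₁)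
open import Data.Sum.Base using (_⊎_; inj₁; inj₂; [_,_])
open import Data.Unit.Polymorphic using (⊤)
open import Data.Vec.Functional using (Vector; []; _∷_)
open import Function.Base using (_∘_; const)
open import Function.Bundles using (_⇔_; module Equivalence)
open import Level using (Level; _⊔_) renaming (suc to lsuc)
open import Relation.Binary.Bundles using (Setoid)
open import Relation.Binary.Construct.Closure.Equivalence using (EqClosure; setoid)
open import Relation.Binary.PropositionalEquality.Core using (_≢_)
open import Relation.Nullary.Negation.Core using (¬_)

private
  variable
    s ℓ ℓ′ : Level

record RelationalLanguage s : Set (lsuc s) where
  field
    Symbol        : Set s
    arity         : Symbol → ℕ
    arity-nonZero : ∀ S → NonZero (arity S)

record Language s : Set (lsuc s) where
  field
    relational : RelationalLanguage s
    Constant   : Set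
  open RelationalLanguage relational public

⟦_⟧ : RelationalLanguage s → Language s
⟦ L ⟧ = record { relational = L ; Constant = ⊥ }

-- Adjoin one new relation symbol of arity r; taking a disjoint sum makes
-- the new symbol, inj₂ _, different from every symbol of L.
_+R_ : RelationalLanguage s → (r : ℕ) → {{NonZero r}} → RelationalLanguage s
_+R_ {s} L r {{r≢0}} = record
  { Symbol        = Symbol ⊎ ⊤ {s}
  ; arity         = [ arity , const r ]
  ; arity-nonZero = λ { (inj₁ S) → arity-nonZero S ; (inj₂ _) → r≢0 }
  }
  where open RelationalLanguage L

_+constants_ : RelationalLanguage s → ℕ → Language s
L +constants r = record { relational = L ; Constant = Fin r }

-- First-order formulas, with de Bruijn variables: Formula L n is the
-- type of formulas whose free variables are among Fin n.
module _ (L : Language s) where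

  open Language L

  data Term (n : ℕ) : Set where
    var : Fin n → Term n
    con : Constant → Term n

  infix  9 _≐_
  infix  8 ¬̇_
  infixr 7 _∧̇_
  infixr 6 _∨̇_
  infixr 5 _⇒̇_

  data Formula (n : ℕ) : Set s where
    _≐_  : Term n → Term n → Formula n
    atom : (S : Symbol) → Vector (Term n) (arity S) → Formula n
    ¬̇_   : Formula n → Formula n
    _∧̇_  : Formula n → Formula n → Formula n
    _∨̇_  : Formula n → Formula n → Formula n
    _⇒̇_  : Formula n → Formula n → Formula n
    ∀̇_   : Formula (suc n) → Formula n
    ∃̇_   : Formula (suc n) → Formula n

  Sentence : Set s
  Sentence = Formula 0

-- The universe is a setoid, so that quotients can be formed; its
-- equivalence _≈_ is the equality of the structure, and in particular is
-- what the equality symbol of the language denotes.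
record Structure (L : Language s) ℓ : Set (s ⊔ lsuc ℓ) where
  open Language L
  field
    universe : Setoid ℓ ℓ
  open Setoid universe public renaming (Carrier to V)
  field
    nonempty     : V
    ⟦_⟧ᴿ         : (S : Symbol) → Vector V (arity S) → Set ℓ
    ⟦⟧ᴿ-respects : ∀ S {x y : Vector V (arity S)} →
                   (∀ i → x i ≈ y i) → ⟦ S ⟧ᴿ x → ⟦ S ⟧ᴿ y
    ⟦_⟧ᶜ         : Constant → V

module Satisfaction {L : Language s} (M : Structure L ℓ) where

  open Structure M

  value : ∀ {n} → Vector V n → Term L n → V
  value ρ (var x) = ρ x
  value ρ (con c) = ⟦ c ⟧ᶜ

  Sat : ∀ {n} → Vector V n → Formula L n → Set ℓ
  Sat ρ (t ≐ u)    = value ρ t ≈ value ρ u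
  Sat ρ (atom S t) = ⟦ S ⟧ᴿ (value ρ ∘ t)
  Sat ρ (¬̇ φ)      = ¬ Sat ρ φ
  Sat ρ (φ ∧̇ ψ)    = Sat ρ φ × Sat ρ ψ
  Sat ρ (φ ∨̇ ψ)    = Sat ρ φ ⊎ Sat ρ ψ
  Sat ρ (φ ⇒̇ ψ)    = Sat ρ φ → Sat ρ ψ
  Sat ρ (∀̇ φ)      = ∀ a → Sat (a ∷ ρ) φ
  Sat ρ (∃̇ φ)      = ∃[ a ] Sat (a ∷ ρ) φ

infix 4 _⊨_ _≡ₑ_

_⊨_ : {L : Language s} → Structure L ℓ → Sentence L → Set ℓ
M ⊨ φ = Satisfaction.Sat M [] φ

_≡ₑ_ : {L : Language s} → Structure L ℓ → Structure L ℓ′ → Set (s ⊔ ℓ ⊔ ℓ′)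
M ≡ₑ N = ∀ φ → M ⊨ φ ⇔ N ⊨ φ

-- "All but finitely many n satisfy P".
Eventually : (ℕ → Set ℓ) → Set ℓ
Eventually P = ∃[ N ] (∀ n → N ≤ n → P n)

ElementarilyConvergent : {L : Language s} → (ℕ → Structure L ℓ) → Set (s ⊔ ℓ)
ElementarilyConvergent M =
  ∀ φ → Eventually (λ n → M n ⊨ φ) ⊎ Eventually (λ n → M n ⊨ ¬̇ φ)

IsElementaryLimit : {L : Language s} →
                    Structure L ℓ′ → (ℕ → Structure L ℓ) → Set (s ⊔ ℓ ⊔ ℓ′)
IsElementaryLimit M∞ M = ∀ φ → M∞ ⊨ φ ⇔ Eventually (λ n → M n ⊨ φ)

module _ (L : RelationalLanguage s) (r : ℕ) {{_ : NonZero r}} where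

  BaseStructure : ∀ ℓ → Set (s ⊔ lsuc ℓ)
  BaseStructure ℓ = Structure ⟦ L +R r ⟧ ℓ

  DistinctRoots : Structure (L +constants r) ℓ → Set ℓ
  DistinctRoots G = ∀ i j → i ≢ j → ¬ (⟦ i ⟧ᶜ ≈ ⟦ j ⟧ᶜ)
    where open Structure G

  record Gadget ℓ : Set (s ⊔ lsuc ℓ) where
    field
      structure     : Structure (L +constants r) ℓ
      distinctRoots : DistinctRoots structure
    open Structure structure public

    root : Fin r → V
    root = ⟦_⟧ᶜ

module _ {L : RelationalLanguage s} {r : ℕ} {{_ : NonZero r}} where

  open RelationalLanguage L

  module GadgetConstruction (A : BaseStructure L r ℓ) (G : Gadget L r ℓ) where

    private
      module A = Structure A
      module G = Gadget G

    Rᴬ : Set ℓ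
    Rᴬ = Σ[ e ∈ Vector A.V r ] A.⟦ inj₂ _ ⟧ᴿ e

    Point : Set ℓ
    Point = A.V ⊎ (Rᴬ × G.V)

    -- The constructors other than glue are the
    -- equality of the disjoint union V(A) ⊔ (R^A × V(G)) itself; tuples
    -- of R^A are compared entrywise, whatever the proofs of membership.
    data Generator : Point → Point → Set ℓ where
      baseEq   : ∀ {a b} → a A.≈ b → Generator (inj₁ a) (inj₁ b)
      gadgetEq : ∀ {e f : Rᴬ} {u v} → (∀ i → proj₁ e i A.≈ proj₁ f i) → u G.≈ v →
                 Generator (inj₂ (e , u)) (inj₂ (f , v))
      glue     : ∀ (e : Rᴬ) i → Generator (inj₁ (proj₁ e i)) (inj₂ (e , G.root i))

    _∼_ : Point → Point → Set ℓ
    _∼_ = EqClosure Generator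

    private
      module Q = Setoid (setoid Generator)

    -- A tuple of classes is in the relation when it is the tuple of classes
    -- of some points of the required form.
    Holds : (S : Symbol) → Vector Point (arity S) → Set ℓ
    Holds S x =
        (∃[ a ] A.⟦ inj₁ S ⟧ᴿ a × (∀ k → x k ∼ inj₁ (a k)))
      ⊎ (∃[ e ] ∃[ v ] G.⟦ S ⟧ᴿ v × (∀ k → x k ∼ inj₂ (e , v k)))

    result : Structure ⟦ L ⟧ ℓ
    result = record
      { universe     = setoid Generator
      ; nonempty     = inj₁ A.nonempty
      ; ⟦_⟧ᴿ         = Holds
      ; ⟦⟧ᴿ-respects = λ where
          S x∼y (inj₁ (a , Sa , p))     → inj₁ (a , Sa , λ k → Q.trans (Q.sym (x∼y k)) (p k))
          S x∼y (inj₂ (e , v , Sv , p)) → inj₂ (e , v , Sv , λ k → Q.trans (Q.sym (x∼y k)) (p k))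
      ; ⟦_⟧ᶜ         = λ ()
      }

  infixl 7 _*_

  _*_ : BaseStructure L r ℓ → Gadget L r ℓ → Structure ⟦ L ⟧ ℓ
  A * G = GadgetConstruction.result A G

  -- Every elementary limit of gadgets has pairwise distinct roots, so that
  -- it is a gadget.
  limitGadget : (G : ℕ → Gadget L r ℓ) (M : Structure (L +constants r) ℓ) →
                IsElementaryLimit M (Gadget.structure ∘ G) → Gadget L r ℓ
  limitGadget G M lim = record
    { structure     = M
    ; distinctRoots = λ i j i≢j zᵢ≈zⱼ →
        let N , eq = Equivalence.to (lim (con i ≐ con j)) zᵢ≈zⱼ
        in Gadget.distinctRoots (G N) i j i≢j (eq N ≤-refl)
    }

{-# OPTIONS --safe #-}

-- A Feferman–Vaught argument.  Tuples of points of A * G are described by a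
-- tuple of A, a list of pairwise distinct edges of R^A (the copies of G that
-- are met), and for each of these copies a tuple of non-root vertices of G.
-- By recursion on φ, satisfaction of φ in A * G is a finite disjunction of
-- conjunctions of one formula of A, one formula of G for each copy, and one
-- sentence of G: a quantifier over points of A * G ranges over base vertices,
-- over non-root vertices of a copy already met and over those of a new copy,
-- and each of these three quantifiers passes through such conjunctions.  For a
-- sentence φ only sentences of A and of G remain, and the disjunction does not
-- depend on A and G, so that it can be evaluated along the two sequences and
-- in their limits.
module Submission where

open import Defs
open import Axiom.ExcludedMiddle using (ExcludedMiddle)
open import Data.Empty using (⊥-elim)
open import Data.Fin.Base using (Fin; zero; suc; _↑ˡ_; _↑ʳ_; fromℕ<; finToFun; funToFin)
open import Data.Fin.Properties using (_≟_; all?; finToFun-funToFin)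
open import Data.List.Base as List using (List; _++_; cartesianProductWith)
open import Data.List.Relation.Unary.Any as Any using (Any; here; there)
import Data.List.Relation.Unary.Any.Properties as Any
open import Data.Nat.Base using (ℕ; zero; suc; _+_; _^_; _⊔_; NonZero; >-nonZero⁻¹)
open import Data.Nat.Properties using (≤-refl; ≤-trans; m≤m⊔n; m≤n⊔m)
open import Data.Product.Relation.Binary.Pointwise.NonDependent using (_×ₛ_)
open import Data.Product.Base as Product using (Σ-syntax; ∃-syntax; _×_; _,_; proj₁; proj₂)
open import Data.Sum.Base as Sum using (_⊎_; inj₁; inj₂)
open import Data.Sum.Relation.Binary.Pointwise using (_⊎ₛ_; inj₁; inj₂)
open import Data.Unit.Polymorphic using (⊤; tt)
open import Data.Vec.Functional using (Vector; []; _∷_; tail)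
open import Data.Vec.Functional.Relation.Binary.Equality.Setoid using (≋-setoid)
open import Function.Base using (_∘_; id)
open import Function.Bundles using (_⇔_; mk⇔; module Equivalence)
open import Level using (Level) renaming (suc to lsuc; _⊔_ to _⊔ˡ_)
open import Relation.Binary.Bundles using (Setoid)
import Relation.Binary.Construct.Closure.Equivalence as EqClosure
import Relation.Binary.Construct.On as On
open import Relation.Binary.PropositionalEquality.Core using (_≡_; refl; sym; trans; cong; subst; subst₂)
open import Relation.Nullary using (Dec; yes; no; ¬_; contradiction)
open import Relation.Nullary.Decidable using (decidable-stable)

open Equivalence using (to; from)

private
  variable
    s p q : Level
    k m n : ℕ

-- Derived connectives, iterated quantifiers and their satisfaction.

module _ {L : Language s} where

  -- The variable is bound because a sentence over a language without constants has no terms to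
  -- equate.
  ⊤̇ : Formula L n
  ⊤̇ = ∀̇ (var zero ≐ var zero)

  ⋀̇ : (Fin k → Formula L n) → Formula L n
  ⋀̇ {zero}  φ = ⊤̇
  ⋀̇ {suc k} φ = φ zero ∧̇ ⋀̇ (φ ∘ suc)

  ∃̇* : ∀ k → Formula L (k + n) → Formula L n
  ∃̇* zero    φ = φ
  ∃̇* (suc k) φ = ∃̇* k (∃̇ φ)

prepend : ∀ {a} {X : Set a} → Vector X k → Vector X m → Vector X (k + m)
prepend {k = zero}  e ρ = ρ
prepend {k = suc k} e ρ = e zero ∷ prepend (tail e) ρ

prepend-↑ˡ : ∀ {a} {X : Set a} (e : Vector X k) (ρ : Vector X m) i → prepend e ρ (i ↑ˡ m) ≡ e i
prepend-↑ˡ e ρ zero    = refl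
prepend-↑ˡ e ρ (suc i) = prepend-↑ˡ (tail e) ρ i

prepend-↑ʳ : ∀ {a} {X : Set a} (e : Vector X k) (ρ : Vector X m) x → prepend e ρ (k ↑ʳ x) ≡ ρ x
prepend-↑ʳ {k = zero}  e ρ x = refl
prepend-↑ʳ {k = suc k} e ρ x = prepend-↑ʳ (tail e) ρ x

module _ {ℓ} {L : Language s} (M : Structure L ℓ) where

  open Structure M using (V; _≈_; ⟦⟧ᴿ-respects) renaming (refl to ≈-refl; sym to ≈-sym; trans to ≈-trans)
  open Satisfaction M

  value-cong : {ρ σ : Vector V n} → (∀ x → ρ x ≈ σ x) → ∀ t → value ρ t ≈ value σ t
  value-cong ρ≈σ (var x) = ρ≈σ x
  value-cong ρ≈σ (con c) = ≈-refl

  ∷-cong : {ρ σ : Vector V n} → (∀ x → ρ x ≈ σ x) → ∀ a x → (a ∷ ρ) x ≈ (a ∷ σ) x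
  ∷-cong ρ≈σ a zero    = ≈-refl
  ∷-cong ρ≈σ a (suc x) = ρ≈σ x

  Sat-cong : {ρ σ : Vector V n} → (∀ x → ρ x ≈ σ x) → ∀ φ → Sat ρ φ → Sat σ φ
  Sat-cong ρ≈σ (t ≐ u)    p        = ≈-trans (≈-sym (value-cong ρ≈σ t)) (≈-trans p (value-cong ρ≈σ u))
  Sat-cong ρ≈σ (atom S t) p        = ⟦⟧ᴿ-respects S (λ i → value-cong ρ≈σ (t i)) p
  Sat-cong ρ≈σ (¬̇ φ)      p        = p ∘ Sat-cong (≈-sym ∘ ρ≈σ) φ
  Sat-cong ρ≈σ (φ ∧̇ ψ)    (p , q)  = Sat-cong ρ≈σ φ p , Sat-cong ρ≈σ ψ q
  Sat-cong ρ≈σ (φ ∨̇ ψ)    (inj₁ p) = inj₁ (Sat-cong ρ≈σ φ p)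
  Sat-cong ρ≈σ (φ ∨̇ ψ)    (inj₂ q) = inj₂ (Sat-cong ρ≈σ ψ q)
  Sat-cong ρ≈σ (φ ⇒̇ ψ)    p        = Sat-cong ρ≈σ ψ ∘ p ∘ Sat-cong (≈-sym ∘ ρ≈σ) φ
  Sat-cong ρ≈σ (∀̇ φ)      p a      = Sat-cong (∷-cong ρ≈σ a) φ (p a)
  Sat-cong ρ≈σ (∃̇ φ)      (a , p)  = a , Sat-cong (∷-cong ρ≈σ a) φ p

  Sat-⋀̇ : {ρ : Vector V n} (φ : Fin k → Formula L n) → Sat ρ (⋀̇ φ) ⇔ (∀ i → Sat ρ (φ i))
  Sat-⋀̇ {k = zero}  φ = mk⇔ (λ _ ()) (λ _ a → ≈-refl)
  Sat-⋀̇ {k = suc k} φ = mk⇔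
    (λ where
      (p , q) zero    → p
      (p , q) (suc i) → to (Sat-⋀̇ (φ ∘ suc)) q i)
    (λ p → p zero , from (Sat-⋀̇ (φ ∘ suc)) (p ∘ suc))

  Sat-∃̇* : ∀ k {ρ : Vector V n} (φ : Formula L (k + n)) →
           Sat ρ (∃̇* k φ) ⇔ (∃[ e ] Sat (prepend {k = k} e ρ) φ)
  Sat-∃̇* zero    φ = mk⇔ (λ p → [] , p) proj₂
  Sat-∃̇* (suc k) φ = mk⇔
    (λ p → let e , a , q = to (Sat-∃̇* k (∃̇ φ)) p in a ∷ e , q)
    (λ (e , p) → from (Sat-∃̇* k (∃̇ φ)) (tail e , e zero , p))

-- Shapes and environments for tuples of points.

module _ {ℓ} (em : ExcludedMiddle ℓ) {s} (L : RelationalLanguage s) (r : ℕ) {{_ : NonZero r}} where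

  open RelationalLanguage L

  private
    LA LG : Language s
    LA = ⟦ L +R r ⟧
    LG = L +constants r

    -- A default root, available since the arity is positive: the value of dummy variables and of
    -- arbitrary choices.
    z₀ : Fin r
    z₀ = fromℕ< (>-nonZero⁻¹ r)

  Edge : BaseStructure L r ℓ → Set ℓ
  Edge A = Σ[ e ∈ Vector V r ] ⟦ inj₂ _ ⟧ᴿ e
    where open Structure A

  NonRoot : Gadget L r ℓ → Set ℓ
  NonRoot G = ∃[ v ] (∀ i → ¬ (v ≈ root i))
    where open Gadget G

  EqualEdges : (A : BaseStructure L r ℓ) → Edge A → Edge A → Set ℓ
  EqualEdges A e f = ∀ i → proj₁ e i ≈ proj₁ f i
    where open Structure A

  -- A shape with n points and k copies: points are added as base vertices or as
  -- non-root vertices of the j-th copy, and a copy when a new edge is chosen.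
  infixl 6 _▸base _▸gadget_ _▸copy

  data Shape : ℕ → ℕ → Set where
    ε         : Shape 0 0
    _▸base    : Shape n k → Shape (suc n) k
    _▸gadget_ : Shape n k → Fin k → Shape (suc n) k
    _▸copy    : Shape n k → Shape n (suc k)

  baseVars : Shape n k → ℕ
  baseVars ε             = 0
  baseVars (σ ▸base)     = suc (baseVars σ)
  baseVars (σ ▸gadget j) = baseVars σ
  baseVars (σ ▸copy)     = r + baseVars σ

  -- A gadget point adds a variable to every copy, a dummy in all but its own,
  -- so that copyVars need not compare copies.
  copyVars : Shape n k → Fin k → ℕ
  copyVars (σ ▸base)     i       = copyVars σ i
  copyVars (σ ▸gadget j) i       = suc (copyVars σ i)
  copyVars (σ ▸copy)     zero    = 0
  copyVars (σ ▸copy)     (suc i) = copyVars σ i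

  -- Defined together with `copies` by induction-recursion: a copy may be added only along an edge
  -- that differs from all those chosen before.
  data Env (A : BaseStructure L r ℓ) (G : Gadget L r ℓ) : Shape n k → Set ℓ
  copies : ∀ {A G} {σ : Shape n k} → Env A G σ → Fin k → Edge A

  NewEdge : ∀ {A G} {σ : Shape n k} → Env A G σ → Set ℓ
  NewEdge {A = A} ρ = ∃[ e ] (∀ j → ¬ EqualEdges A e (copies ρ j))

  data Env A G where
    ε      : Env A G ε
    base   : {σ : Shape n k} → Env A G σ → Structure.V A → Env A G (σ ▸base)
    gadget : {σ : Shape n k} → Env A G σ → (j : Fin k) → NonRoot G → Env A G (σ ▸gadget j)
    copy   : {σ : Shape n k} (ρ : Env A G σ) → NewEdge ρ → Env A G (σ ▸copy)

  copies (base ρ a)     i       = copies ρ i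
  copies (gadget ρ j v) i       = copies ρ i
  copies (copy ρ e)     zero    = proj₁ e
  copies (copy ρ e)     (suc i) = copies ρ i

  -- The decision is an argument so that proofs about `copyEnv` can match on it.
  entry : ∀ G {i j : Fin k} → NonRoot G → Dec (i ≡ j) → Gadget.V G
  entry G v (yes _) = proj₁ v
  entry G v (no  _) = Gadget.root G z₀

  module _ {A : BaseStructure L r ℓ} {G : Gadget L r ℓ} where

    private
      module A = Structure A
      module G = Gadget G

    baseEnv : {σ : Shape n k} → Env A G σ → Vector A.V (baseVars σ)
    baseEnv ε              = []
    baseEnv (base ρ a)     = a ∷ baseEnv ρ
    baseEnv (gadget ρ j v) = baseEnv ρ
    baseEnv (copy ρ e)     = prepend (proj₁ (proj₁ e)) (baseEnv ρ)

    copyEnv : {σ : Shape n k} → Env A G σ → ∀ i → Vector G.V (copyVars σ i)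
    copyEnv (base ρ a)     i       = copyEnv ρ i
    copyEnv (gadget ρ j v) i       = entry G v (i ≟ j) ∷ copyEnv ρ i
    copyEnv (copy ρ e)     zero    = []
    copyEnv (copy ρ e)     (suc i) = copyEnv ρ i

    points : {σ : Shape n k} → Env A G σ → Vector (Structure.V (A * G)) n
    points ε              = []
    points (base ρ a)     = inj₁ a ∷ points ρ
    points (gadget ρ j v) = inj₂ (copies ρ j , proj₁ v) ∷ points ρ
    points (copy ρ e)     = points ρ

    -- Guaranteed by the condition in `NewEdge`. It separates points that lie in copies with
    -- different indices.
    copies-injective : {σ : Shape n k} (ρ : Env A G σ) →
                       ∀ i j → EqualEdges A (copies ρ i) (copies ρ j) → i ≡ j
    copies-injective (base ρ a)     i       j       eq = copies-injective ρ i j eq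
    copies-injective (gadget ρ _ v) i       j       eq = copies-injective ρ i j eq
    copies-injective (copy ρ e)     zero    zero    eq = refl
    copies-injective (copy ρ e)     zero    (suc j) eq = contradiction eq (proj₂ e j)
    copies-injective (copy ρ e)     (suc i) zero    eq = contradiction (A.sym ∘ eq) (proj₂ e i)
    copies-injective (copy ρ e)     (suc i) (suc j) eq = cong suc (copies-injective ρ i j eq)

    isCopy? : {σ : Shape n k} (ρ : Env A G σ) (e : Edge A) →
              (∃[ j ] EqualEdges A e (copies ρ j)) ⊎ (∀ j → ¬ EqualEdges A e (copies ρ j))
    isCopy? ρ e with em {∃[ j ] EqualEdges A e (copies ρ j)}
    ... | yes p = inj₁ p
    ... | no ¬p = inj₂ (λ j q → ¬p (j , q))

  -- Adding a copy puts the entries of its edge in front of the base environment; these variables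
  -- let formulas of A speak about the edges already chosen.
  tuple : (σ : Shape n k) → Fin k → Fin r → Fin (baseVars σ)
  tuple (σ ▸base)     j       i = suc (tuple σ j i)
  tuple (σ ▸gadget _) j       i = tuple σ j i
  tuple (σ ▸copy)     zero    i = i ↑ˡ baseVars σ
  tuple (σ ▸copy)     (suc j) i = r ↑ʳ tuple σ j i

  baseEnv-tuple : ∀ {A G} {σ : Shape n k} (ρ : Env A G σ) j i →
                  baseEnv ρ (tuple σ j i) ≡ proj₁ (copies ρ j) i
  baseEnv-tuple (base ρ a)     j       i = baseEnv-tuple ρ j i
  baseEnv-tuple (gadget ρ _ v) j       i = baseEnv-tuple ρ j i
  baseEnv-tuple (copy ρ e)     zero    i = prepend-↑ˡ (proj₁ (proj₁ e)) (baseEnv ρ) i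
  baseEnv-tuple (copy ρ e)     (suc j) i =
    trans (prepend-↑ʳ (proj₁ (proj₁ e)) (baseEnv ρ) _) (baseEnv-tuple ρ j i)

  -- Clauses and definable predicates.

  record Clause (σ : Shape n k) : Set s where
    constructor clause
    field
      onBase   : Formula LA (baseVars σ)
      onCopy   : ∀ i → Formula LG (copyVars σ i)
      -- Also collects what is demanded of copies that have been quantified away.
      onGadget : Sentence LG

  open Clause

  _⊩_ : ∀ {A G} {σ : Shape n k} → Env A G σ → Clause σ → Set ℓ
  _⊩_ {A = A} {G} ρ c =
      Satisfaction.Sat A (baseEnv ρ) (onBase c)
    × (∀ i → Satisfaction.Sat (Gadget.structure G) (copyEnv ρ i) (onCopy c i))
    × Gadget.structure G ⊨ onGadget c

  Predicate : ∀ p → Shape n k → Set (s ⊔ˡ lsuc (ℓ ⊔ˡ p))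
  Predicate p σ = ∀ A G → Env A G σ → Set p

  -- One list of clauses has to serve all A and G; this uniformity permits the passage to sequences
  -- and limits.
  record Definable {σ : Shape n k} (P : Predicate p σ) : Set (s ⊔ˡ lsuc ℓ ⊔ˡ p) where
    constructor definable
    field
      clauses : List (Clause σ)
      defines : ∀ {A G} (ρ : Env A G σ) → Any (ρ ⊩_) clauses ⇔ P A G ρ

  -- Closure of definability under Boolean operations.

  module _ {σ : Shape n k} where

    definable-resp : {P : Predicate p σ} {Q : Predicate q σ} → (∀ {A G} (ρ : Env A G σ) → P A G ρ ⇔ Q A G ρ) →
                     Definable P → Definable Q
    definable-resp P⇔Q (definable d d⇔P) = definable d λ ρ →
      mk⇔ (to (P⇔Q ρ) ∘ to (d⇔P ρ)) (from (d⇔P ρ) ∘ from (P⇔Q ρ))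

    definable-clause : (c : Clause σ) → Definable (λ A G ρ → ρ ⊩ c)
    definable-clause c = definable List.[ c ] λ ρ → mk⇔ Any.singleton⁻ Any.singleton⁺

    definable-empty : {P : Predicate p σ} → (∀ {A G} (ρ : Env A G σ) → ¬ P A G ρ) → Definable P
    definable-empty ¬P = definable List.[] λ ρ → mk⇔ (λ ()) (⊥-elim ∘ ¬P ρ)

    definable-⊎ : {P : Predicate p σ} {Q : Predicate q σ} → Definable P → Definable Q →
                  Definable (λ A G ρ → P A G ρ ⊎ Q A G ρ)
    definable-⊎ (definable d d⇔P) (definable d′ d′⇔Q) = definable (d ++ d′) λ ρ → mk⇔
      (Sum.map (to (d⇔P ρ)) (to (d′⇔Q ρ)) ∘ Any.++⁻ d)
      Sum.[ Any.++⁺ˡ ∘ from (d⇔P ρ) , Any.++⁺ʳ d ∘ from (d′⇔Q ρ) ]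

    definable-× : {P : Predicate p σ} {Q : Predicate q σ} → Definable P → Definable Q →
                  Definable (λ A G ρ → P A G ρ × Q A G ρ)
    definable-× (definable d d⇔P) (definable d′ d′⇔Q) =
      definable (cartesianProductWith _∧ᶜ_ d d′) λ ρ → mk⇔
        (Product.map (to (d⇔P ρ)) (to (d′⇔Q ρ)) ∘ Any.cartesianProductWith⁻ _∧ᶜ_ (λ {c} {c′} → split ρ c c′) d d′)
        (λ (p , q) → Any.cartesianProductWith⁺ _∧ᶜ_ (λ {c} {c′} → join ρ c c′) (from (d⇔P ρ) p) (from (d′⇔Q ρ) q))
      where
      _∧ᶜ_ : Clause σ → Clause σ → Clause σ
      c ∧ᶜ c′ = clause (onBase c ∧̇ onBase c′) (λ i → onCopy c i ∧̇ onCopy c′ i)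
                       (onGadget c ∧̇ onGadget c′)

      split : ∀ {A G} (ρ : Env A G σ) c c′ → ρ ⊩ (c ∧ᶜ c′) → ρ ⊩ c × ρ ⊩ c′
      split ρ _ _ ((α , α′) , γ , (g , g′)) = (α , proj₁ ∘ γ , g) , (α′ , proj₂ ∘ γ , g′)

      join : ∀ {A G} (ρ : Env A G σ) c c′ → ρ ⊩ c → ρ ⊩ c′ → ρ ⊩ (c ∧ᶜ c′)
      join ρ _ _ (α , γ , g) (α′ , γ′ , g′) = (α , α′) , (λ i → γ i , γ′ i) , (g , g′)

    definable-∃Fin : ∀ N {P : Fin N → Predicate p σ} → (∀ i → Definable (P i)) →
                     Definable (λ A G ρ → ∃[ i ] P i A G ρ)
    definable-∃Fin zero    dP = definable-empty λ { ρ (() , _) }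
    definable-∃Fin (suc N) dP = definable-resp
      (λ ρ → mk⇔ (λ { (inj₁ p) → zero , p ; (inj₂ (i , p)) → suc i , p })
                 (λ { (zero , p) → inj₁ p ; (suc i , p) → inj₂ (i , p) }))
      (definable-⊎ (dP zero) (definable-∃Fin N (dP ∘ suc)))

    definable-base : (α : Formula LA (baseVars σ)) →
                     Definable (λ A G ρ → Satisfaction.Sat A (baseEnv ρ) α)
    definable-base α = definable-resp
      (λ {A} {G} ρ → mk⇔ proj₁ (λ p → p , (λ i a → Gadget.refl G) , λ a → Gadget.refl G))
      (definable-clause (clause α (λ _ → ⊤̇) ⊤̇))

    definable-gadget : (γ : Sentence LG) → Definable (λ A G ρ → Gadget.structure G ⊨ γ)
    definable-gadget γ = definable-resp
      (λ {A} {G} ρ → mk⇔ (proj₂ ∘ proj₂) (λ p → (λ a → Structure.refl A) , (λ i a → Gadget.refl G) , p))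
      (definable-clause (clause ⊤̇ (λ _ → ⊤̇) γ))

    definable-copy : ∀ j (γ : Formula LG (copyVars σ j)) →
                     Definable (λ A G ρ → Satisfaction.Sat (Gadget.structure G) (copyEnv ρ j) γ)
    definable-copy j γ = definable-resp
      (λ {A} {G} ρ → mk⇔ (λ (_ , p , _) → at-self ρ (j ≟ j) (p j))
                         (λ p → (λ a → Structure.refl A) , (λ i → at-any ρ (i ≟ j) p) , λ a → Gadget.refl G))
      (definable-clause (clause ⊤̇ (λ i → at (i ≟ j)) ⊤̇))
      where
      at : ∀ {i} → Dec (i ≡ j) → Formula LG (copyVars σ i)
      at (yes refl) = γ
      at (no _)     = ⊤̇

      at-self : ∀ {A G} (ρ : Env A G σ) (d : Dec (j ≡ j)) →
                Satisfaction.Sat (Gadget.structure G) (copyEnv ρ j) (at d) →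
                Satisfaction.Sat (Gadget.structure G) (copyEnv ρ j) γ
      at-self ρ (yes refl) p = p
      at-self ρ (no j≢j)   p = contradiction refl j≢j

      at-any : ∀ {A G} (ρ : Env A G σ) {i} (d : Dec (i ≡ j)) →
               Satisfaction.Sat (Gadget.structure G) (copyEnv ρ j) γ →
               Satisfaction.Sat (Gadget.structure G) (copyEnv ρ i) (at d)
      at-any         ρ (yes refl) p = p
      at-any {G = G} ρ (no _)     p = λ a → Gadget.refl G

    -- By De Morgan: a clause fails exactly when one of its finitely many conjuncts fails. Excluded
    -- middle finds which one.
    definable-¬clause : (c : Clause σ) → Definable (λ A G ρ → ¬ ρ ⊩ c)
    definable-¬clause c = definable-resp
      (λ ρ → mk⇔ refute (split ρ))
      (definable-⊎ (definable-base (¬̇ onBase c))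
        (definable-⊎ (definable-∃Fin k (λ i → definable-copy i (¬̇ onCopy c i)))
                     (definable-gadget (¬̇ onGadget c))))
      where
      refute : ∀ {X Y : Set ℓ} {Z : Fin k → Set ℓ} →
               ¬ X ⊎ (∃[ i ] ¬ Z i) ⊎ ¬ Y → ¬ (X × (∀ i → Z i) × Y)
      refute (inj₁ ¬x)              (x , _ , _) = ¬x x
      refute (inj₂ (inj₁ (i , ¬z))) (_ , z , _) = ¬z (z i)
      refute (inj₂ (inj₂ ¬y))       (_ , _ , y) = ¬y y

      split : ∀ {A G} (ρ : Env A G σ) → ¬ ρ ⊩ c →
              ¬ Satisfaction.Sat A (baseEnv ρ) (onBase c)
              ⊎ (∃[ i ] ¬ Satisfaction.Sat (Gadget.structure G) (copyEnv ρ i) (onCopy c i))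
              ⊎ ¬ Gadget.structure G ⊨ onGadget c
      split {A} {G} ρ ¬c
        with em {Satisfaction.Sat A (baseEnv ρ) (onBase c)}
           | em {∃[ i ] ¬ Satisfaction.Sat (Gadget.structure G) (copyEnv ρ i) (onCopy c i)}
           | em {Gadget.structure G ⊨ onGadget c}
      ... | no ¬α | _     | _     = inj₁ ¬α
      ... | yes α | yes q | _     = inj₂ (inj₁ q)
      ... | yes α | no ¬q | no ¬g = inj₂ (inj₂ ¬g)
      ... | yes α | no ¬q | yes g = contradiction (α , all , g) ¬c
        where
        all : ∀ i → Satisfaction.Sat (Gadget.structure G) (copyEnv ρ i) (onCopy c i)
        all i with em {Satisfaction.Sat (Gadget.structure G) (copyEnv ρ i) (onCopy c i)}
        ... | yes p = p
        ... | no ¬p = contradiction (i , ¬p) ¬q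

    -- A negated disjunction is the conjunction of the negated clauses, which `definable-×`
    -- distributes into a disjunction again.
    definable-¬ : {P : Predicate p σ} → Definable P → Definable (λ A G ρ → ¬ P A G ρ)
    definable-¬ (definable d d⇔P) = definable-resp
      (λ ρ → mk⇔ (_∘ from (d⇔P ρ)) (_∘ to (d⇔P ρ))) (none d)
      where
      none : (d : List (Clause σ)) → Definable (λ A G ρ → ¬ Any (ρ ⊩_) d)
      none List.[]      = definable-resp (λ {A} ρ → mk⇔ (λ _ ()) (λ _ a → Structure.refl A)) (definable-base ⊤̇)
      none (c List.∷ d) = definable-resp
        (λ ρ → mk⇔ (λ { (¬p , ¬q) (here p) → ¬p p ; (¬p , ¬q) (there q) → ¬q q })
                   (λ ¬p → ¬p ∘ here , ¬p ∘ there))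
        (definable-× (definable-¬clause c) (none d))

    definable-→ : {P Q : Predicate ℓ σ} → Definable P → Definable Q →
                  Definable (λ A G ρ → P A G ρ → Q A G ρ)
    definable-→ {P} {Q} dP dQ = definable-resp
      (λ ρ → mk⇔ (λ { (inj₁ ¬p) p → contradiction p ¬p ; (inj₂ q) p → q }) (decide ρ))
      (definable-⊎ (definable-¬ dP) dQ)
      where
      decide : ∀ {A G} (ρ : Env A G σ) → (P A G ρ → Q A G ρ) → ¬ P A G ρ ⊎ Q A G ρ
      decide {A} {G} ρ f with em {P A G ρ}
      ... | yes p = inj₂ (f p)
      ... | no ¬p = inj₁ ¬p

  -- Elimination of existential quantifiers from clauses.

  module _ {n′ k′} {σ : Shape n k} {σ′ : Shape n′ k′}
           {X : ∀ {A G} → Env A G σ → Set ℓ}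
           (extend : ∀ {A G} (ρ : Env A G σ) → X ρ → Env A G σ′)
           (eliminate : Clause σ′ → Clause σ)
           (eliminates : ∀ {A G} (ρ : Env A G σ) c → ρ ⊩ eliminate c ⇔ (∃[ x ] extend ρ x ⊩ c))
           where

    -- Existential quantifiers commute with disjunctions, so eliminating one from single clauses
    -- suffices.
    definable-∃ : {P : Predicate p σ′} → Definable P →
                  Definable (λ A G ρ → ∃[ x ] P A G (extend ρ x))
    definable-∃ (definable d d⇔P) = definable (List.map eliminate d) λ ρ → mk⇔
      (λ q → let x , q′ = Any.Any-Σ⁻ʳ (Any.map (λ {c} → to (eliminates ρ c)) (Any.map⁻ q))
             in x , to (d⇔P (extend ρ x)) q′)
      (λ (x , q) → Any.map⁺ (Any.map (λ {c} → from (eliminates ρ c) ∘ (x ,_)) (from (d⇔P (extend ρ x)) q)))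

  -- A new base vertex is seen only by the formula of A, so the quantifier moves into that conjunct.
  definable-∃base : {σ : Shape n k} {P : Predicate p (σ ▸base)} → Definable P →
                    Definable (λ A G ρ → ∃[ a ] P A G (base ρ a))
  definable-∃base = definable-∃ base
    (λ c → clause (∃̇ onBase c) (onCopy c) (onGadget c))
    (λ ρ c → mk⇔ (λ ((a , α) , γ , g) → a , α , γ , g) (λ (a , α , γ , g) → (a , α) , γ , g))

  module _ {σ : Shape n k} (j : Fin k) where

    private
      -- Environments interpret dummies by the root z₀, which eliminates them.
      pin : ∀ {i} → Dec (i ≡ j) → Formula LG (suc (copyVars σ i)) → Formula LG (copyVars σ i)
      pin (yes _) γ = ∃̇ (⋀̇ (λ l → ¬̇ (var zero ≐ con l)) ∧̇ γ)
      pin (no _)  γ = ∃̇ (var zero ≐ con z₀ ∧̇ γ)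

      module _ {A : BaseStructure L r ℓ} {G : Gadget L r ℓ} (ρ : Env A G σ) where

        open Satisfaction (Gadget.structure G)

        pin-self : (d : Dec (j ≡ j)) (γ : Formula LG (suc (copyVars σ j))) → Sat (copyEnv ρ j) (pin d γ) →
                   Σ[ v ∈ NonRoot G ] Sat (proj₁ v ∷ copyEnv ρ j) γ
        pin-self (yes _)  γ (v , nonRoot , q) = (v , to (Sat-⋀̇ (Gadget.structure G) _) nonRoot) , q
        pin-self (no j≢j) γ _                 = contradiction refl j≢j

        -- All conjuncts must share one vertex `v`, so the witness that `pin-self` finds in copy `j`
        -- is passed in. In any other copy the bound variable is forced to equal `z₀`, which is the
        -- value `entry` gives it.
        pin⁻ : ∀ {i} (d : Dec (i ≡ j)) (γ : ∀ i → Formula LG (suc (copyVars σ i))) (v : NonRoot G) →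
               Sat (proj₁ v ∷ copyEnv ρ j) (γ j) → Sat (copyEnv ρ i) (pin d (γ i)) →
               Sat (entry G v d ∷ copyEnv ρ i) (γ i)
        pin⁻     (yes refl) γ v q _             = q
        pin⁻ {i} (no _)     γ v _ (w , eq , q) = Sat-cong (Gadget.structure G)
          (λ { zero → eq ; (suc x) → Gadget.refl G }) (γ i) q

        pin⁺ : ∀ {i} (d : Dec (i ≡ j)) (γ : Formula LG (suc (copyVars σ i))) (v : NonRoot G) →
               Sat (entry G v d ∷ copyEnv ρ i) γ → Sat (copyEnv ρ i) (pin d γ)
        pin⁺ (yes _) γ v q = proj₁ v , from (Sat-⋀̇ (Gadget.structure G) _) (proj₂ v) , q
        pin⁺ (no _)  γ v q = _ , Gadget.refl G , q

    definable-∃gadget : {P : Predicate p (σ ▸gadget j)} → Definable P →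
                        Definable (λ A G ρ → ∃[ v ] P A G (gadget ρ j v))
    definable-∃gadget = definable-∃ (λ ρ → gadget ρ j)
      (λ c → clause (onBase c) (λ i → pin (i ≟ j) (onCopy c i)) (onGadget c))
      (λ ρ c → mk⇔
        (λ (α , γ , g) →
          let v , q = pin-self ρ (j ≟ j) (onCopy c j) (γ j)
          in v , α , (λ i → pin⁻ ρ (i ≟ j) (onCopy c) v q (γ i)) , g)
        (λ (v , α , γ , g) → α , (λ i → pin⁺ ρ (i ≟ j) (onCopy c i) v (γ i)) , g))

  module _ {σ : Shape n k} where

    private
      edge new : Formula LA (r + baseVars σ)
      edge = atom (inj₂ _) (λ i → var (i ↑ˡ baseVars σ))
      new  = ⋀̇ (λ j → ¬̇ ⋀̇ (λ i → var (i ↑ˡ baseVars σ) ≐ var (r ↑ʳ tuple σ j i)))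

      module _ {A : BaseStructure L r ℓ} {G : Gadget L r ℓ} (ρ : Env A G σ) where

        open Structure A using (V; _≈_; ⟦_⟧ᴿ; ⟦⟧ᴿ-respects; reflexive)
          renaming (refl to ≈-refl; sym to ≈-sym; trans to ≈-trans)
        open Satisfaction A

        private
          module _ (e : Vector V r) where
            env : Vector V (r + baseVars σ)
            env = prepend e (baseEnv ρ)

            here-≈ : ∀ i → env (i ↑ˡ baseVars σ) ≈ e i
            here-≈ i = reflexive (prepend-↑ˡ e (baseEnv ρ) i)

            there-≈ : ∀ j i → env (r ↑ʳ tuple σ j i) ≈ proj₁ (copies ρ j) i
            there-≈ j i = reflexive (trans (prepend-↑ʳ e (baseEnv ρ) _) (baseEnv-tuple ρ j i))

        Sat-edge : ∀ e → Sat (env e) edge ⇔ ⟦ inj₂ _ ⟧ᴿ e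
        Sat-edge e = mk⇔ (⟦⟧ᴿ-respects (inj₂ _) (here-≈ e)) (⟦⟧ᴿ-respects (inj₂ _) (≈-sym ∘ here-≈ e))

        Sat-new : ∀ e → Sat (env e) new ⇔ (∀ j → ¬ (∀ i → e i ≈ proj₁ (copies ρ j) i))
        Sat-new e = mk⇔
          (λ q j eq → to (Sat-⋀̇ A _) q j (from (Sat-⋀̇ A _)
             (λ i → ≈-trans (here-≈ e i) (≈-trans (eq i) (≈-sym (there-≈ e j i))))))
          (λ q → from (Sat-⋀̇ A _) (λ j eq → q j
             (λ i → ≈-trans (≈-sym (here-≈ e i)) (≈-trans (to (Sat-⋀̇ A _) eq i) (there-≈ e j i)))))

    -- The new copy has no variable yet, so that its formula is a sentence of G
    -- and can be kept when the copy is dropped.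
    definable-∃copy : {P : Predicate p (σ ▸copy)} → Definable P →
                      Definable (λ A G ρ → ∃[ e ] P A G (copy ρ e))
    definable-∃copy = definable-∃ copy
      (λ c → clause (∃̇* r (edge ∧̇ new ∧̇ onBase c)) (onCopy c ∘ suc) (onGadget c ∧̇ onCopy c zero))
      (λ {A} ρ c → mk⇔
        (λ (α , γ , (g , γ₀)) →
          let e , Re , e-new , α′ = to (Sat-∃̇* A r _) α
          in ((e , to (Sat-edge ρ e) Re) , to (Sat-new ρ e) e-new)
             , α′ , (λ { zero → γ₀ ; (suc i) → γ i }) , g)
        (λ (((e , Re) , e-new) , α , γ , g) →
          from (Sat-∃̇* A r _) (e , from (Sat-edge ρ e) Re , from (Sat-new ρ e) e-new , α)
          , γ ∘ suc , (g , γ zero)))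

  -- Equality of points in A * G.

  module _ {A : BaseStructure L r ℓ} {G : Gadget L r ℓ} where

    open GadgetConstruction A G using (Point; Generator; baseEq; gadgetEq; glue; _∼_)

    private
      module A  = Structure A
      module G  = Gadget G
      module A*G = Structure (A * G)

      -- The disjoint union before gluing, with edges compared entrywise; `canonical` embeds the
      -- quotient into it.
      points-setoid : Setoid ℓ ℓ
      points-setoid = A.universe ⊎ₛ (On.setoid {B = Edge A} (≋-setoid A.universe r) proj₁ ×ₛ G.universe)

      open Setoid points-setoid using () renaming (_≈_ to _≋_)

      canonical-copy : Edge A → (v : G.V) → Dec (∃[ i ] v G.≈ G.root i) → Point
      canonical-copy e v (yes (i , _)) = inj₁ (proj₁ e i)
      canonical-copy e v (no _)        = inj₂ (e , v)

      -- A root of a copy is moved to the base vertex it is glued to, so that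
      -- ∼ becomes the equality of the disjoint union.
      canonical : Point → Point
      canonical (inj₁ a)       = inj₁ a
      canonical (inj₂ (e , v)) = canonical-copy e v em

      -- Distinctness of the roots makes `canonical` independent of the index that excluded middle
      -- happens to return.
      root-injective : ∀ i j → G.root i G.≈ G.root j → i ≡ j
      root-injective i j eq with i ≟ j
      ... | yes i≡j = i≡j
      ... | no i≢j  = contradiction eq (G.distinctRoots i j i≢j)

      canonical-copy-cong : ∀ {e f u v} d d′ → EqualEdges A e f → u G.≈ v →
                            canonical-copy e u d ≋ canonical-copy f v d′
      canonical-copy-cong {f = f} (yes (i , p)) (yes (j , q)) e≈f u≈v
        with refl ← root-injective i j (G.trans (G.sym p) (G.trans u≈v q)) = inj₁ (e≈f i)
      canonical-copy-cong (yes (i , p)) (no ¬q)       e≈f u≈v = contradiction (i , G.trans (G.sym u≈v) p) ¬q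
      canonical-copy-cong (no ¬p)       (yes (j , q)) e≈f u≈v = contradiction (j , G.trans u≈v q) ¬p
      canonical-copy-cong (no ¬p)       (no ¬q)       e≈f u≈v = inj₂ (e≈f , u≈v)

      canonical-glue : ∀ e i d → inj₁ (proj₁ e i) ≋ canonical-copy e (G.root i) d
      canonical-glue e i (yes (j , p)) with refl ← root-injective i j p = inj₁ A.refl
      canonical-glue e i (no ¬p)       = contradiction (i , G.refl) ¬p

      canonical-generator : ∀ {x y} → Generator x y → canonical x ≋ canonical y
      canonical-generator (baseEq a≈b)       = inj₁ a≈b
      canonical-generator (gadgetEq e≈f u≈v) = canonical-copy-cong em em e≈f u≈v
      canonical-generator (glue e i)         = canonical-glue e i em

      -- As `∼` is the least equivalence containing the generators, checking the generators is
      -- enough.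
      canonical-cong : ∀ {x y} → x ∼ y → canonical x ≋ canonical y
      canonical-cong = EqClosure.gfold (Setoid.isEquivalence points-setoid) canonical canonical-generator

    base-∼-base : ∀ {a b} → inj₁ a ∼ inj₁ b → a A.≈ b
    base-∼-base a∼b with inj₁ a≈b ← canonical-cong a∼b = a≈b

    -- `canonical` fixes base vertices, so it must send the point of the copy to a base vertex too,
    -- which happens only at a root.
    base-∼-copy : ∀ {a e v} → inj₁ a ∼ inj₂ (e , v) → ∃[ i ] a A.≈ proj₁ e i × v G.≈ G.root i
    base-∼-copy {a} {e} {v} a∼v = invert em (canonical-cong a∼v)
      where
      invert : ∀ d → inj₁ a ≋ canonical-copy e v d → ∃[ i ] a A.≈ proj₁ e i × v G.≈ G.root i
      invert (yes (i , v≈z)) (inj₁ a≈e) = i , a≈e , v≈z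

    -- `canonical` leaves the non-root `u` in its copy, hence `v` as well, and equality in the
    -- disjoint union splits into components.
    copy-∼-copy : ∀ {e f u v} → (∀ i → ¬ (u G.≈ G.root i)) → inj₂ (e , u) ∼ inj₂ (f , v) →
                  EqualEdges A e f × u G.≈ v
    copy-∼-copy {e} {f} {u} {v} nonRoot u∼v = invert em em (canonical-cong u∼v)
      where
      invert : ∀ d d′ → canonical-copy e u d ≋ canonical-copy f v d′ → EqualEdges A e f × u G.≈ v
      invert (yes (i , u≈z)) _      _        = contradiction u≈z (nonRoot i)
      invert (no _)          (no _) (inj₂ p) = p

    ∼-base : ∀ {a b} → a A.≈ b → inj₁ a ∼ inj₁ b
    ∼-base = EqClosure.return ∘ baseEq

    ∼-copy : ∀ {e f u v} → EqualEdges A e f → u G.≈ v → inj₂ (e , u) ∼ inj₂ (f , v)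
    ∼-copy e≈f u≈v = EqClosure.return (gadgetEq e≈f u≈v)

    ∼-root : ∀ {a e v} i → a A.≈ proj₁ e i → v G.≈ G.root i → inj₁ a ∼ inj₂ (e , v)
    ∼-root {e = e} i a≈e v≈z = A*G.trans (∼-base a≈e)
      (A*G.trans (EqClosure.return (glue e i)) (∼-copy (λ _ → A.refl) (G.sym v≈z)))

  -- Locations of points among the variables.

  Location : Shape n k → Set
  Location {k = k} σ = Fin (baseVars σ) ⊎ (Σ[ j ∈ Fin k ] Fin (copyVars σ j))

  -- Computed from the shape alone, so that case distinctions on it are made before A and G are
  -- given.
  location : (σ : Shape n k) → Fin n → Location σ
  location (σ ▸base)     zero    = inj₁ zero
  location (σ ▸base)     (suc x) = Sum.map suc id (location σ x)
  location (σ ▸gadget j) zero    = inj₂ (j , zero)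
  location (σ ▸gadget j) (suc x) = Sum.map id (Product.map₂ suc) (location σ x)
  location (σ ▸copy)     x       = Sum.map (r ↑ʳ_) (λ (j , y) → suc j , y) (location σ x)

  pointAt : ∀ {A G} {σ : Shape n k} → Env A G σ → Location σ → Structure.V (A * G)
  pointAt ρ (inj₁ y)       = inj₁ (baseEnv ρ y)
  pointAt ρ (inj₂ (j , y)) = inj₂ (copies ρ j , copyEnv ρ j y)

  -- This fails at dummy variables, which denote the root `z₀`, but `location` never returns a
  -- dummy.
  NonRootAt : ∀ {A G} {σ : Shape n k} → Env A G σ → Location σ → Set ℓ
  NonRootAt         ρ (inj₁ y)       = ⊤
  NonRootAt {G = G} ρ (inj₂ (j , y)) = ∀ i → ¬ (copyEnv ρ j y ≈ root i)
    where open Gadget G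

  pointAt-location : ∀ {A G} {σ : Shape n k} (ρ : Env A G σ) x →
                     pointAt ρ (location σ x) ≡ points ρ x × NonRootAt ρ (location σ x)
  pointAt-location (base ρ a)     zero    = refl , tt
  pointAt-location {σ = σ ▸base} (base ρ a) (suc x) with location σ x | pointAt-location ρ x
  ... | inj₁ _ | p = p
  ... | inj₂ _ | p = p
  pointAt-location (gadget ρ j v) zero    with j ≟ j
  ... | yes _   = refl , proj₂ v
  ... | no j≢j  = contradiction refl j≢j
  pointAt-location {σ = σ ▸gadget _} (gadget ρ j v) (suc x) with location σ x | pointAt-location ρ x
  ... | inj₁ _ | p = p
  ... | inj₂ _ | p = p
  pointAt-location {σ = σ ▸copy} (copy ρ ((e , _) , _)) x with location σ x | pointAt-location ρ x
  ... | inj₁ y | p , _ = trans (cong inj₁ (prepend-↑ʳ e (baseEnv ρ) y)) p , tt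
  ... | inj₂ _ | p = p

  termLocation : (σ : Shape n k) → Term ⟦ L ⟧ n → Location σ
  termLocation σ (var x) = location σ x

  private
    valueOf : ∀ {A G} {σ : Shape n k} → Env A G σ → Term ⟦ L ⟧ n → Structure.V (A * G)
    valueOf {A = A} {G} ρ = Satisfaction.value (A * G) (points ρ)

  pointAt-term : ∀ {A G} {σ : Shape n k} (ρ : Env A G σ) t →
                 pointAt ρ (termLocation σ t) ≡ valueOf ρ t × NonRootAt ρ (termLocation σ t)
  pointAt-term ρ (var x) = pointAt-location ρ x

  -- Definability of atomic formulas.

  module _ {σ : Shape n k} where

    -- Non-root vertices are not glued to anything, so points at locations of different sorts, or in
    -- different copies, are never equal.
    definable-≈At : (l l′ : Location σ) →
                    (∀ {A G} (ρ : Env A G σ) → NonRootAt ρ l) →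
                    (∀ {A G} (ρ : Env A G σ) → NonRootAt ρ l′) →
                    Definable (λ A G ρ → Structure._≈_ (A * G) (pointAt {σ = σ} ρ l) (pointAt ρ l′))
    definable-≈At (inj₁ y) (inj₁ y′) _ _ = definable-resp
      (λ ρ → mk⇔ ∼-base base-∼-base) (definable-base (var y ≐ var y′))
    definable-≈At (inj₁ y) (inj₂ (j , y′)) _ nonRoot = definable-empty
      (λ ρ eq → let i , _ , v≈z = base-∼-copy eq in nonRoot ρ i v≈z)
    definable-≈At (inj₂ (j , y)) (inj₁ y′) nonRoot _ = definable-empty
      (λ {A} {G} ρ eq → let i , _ , v≈z = base-∼-copy (Structure.sym (A * G) eq) in nonRoot ρ i v≈z)
    definable-≈At (inj₂ (j , y)) (inj₂ (j′ , y′)) nonRoot _ with j ≟ j′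
    ... | yes refl = definable-resp
      (λ {A} ρ → mk⇔ (∼-copy (λ _ → Structure.refl A)) (proj₂ ∘ copy-∼-copy (nonRoot ρ)))
      (definable-copy j (var y ≐ var y′))
    ... | no j≢j′  = definable-empty
      (λ ρ eq → j≢j′ (copies-injective ρ j j′ (proj₁ (copy-∼-copy (nonRoot ρ) eq))))

    definable-≐ : ∀ t u → Definable (λ A G ρ → Structure._≈_ (A * G) (valueOf {σ = σ} ρ t) (valueOf ρ u))
    definable-≐ t u = definable-resp
      (λ {A} {G} ρ →
        let p = proj₁ (pointAt-term ρ t) ; q = proj₁ (pointAt-term ρ u)
        in mk⇔ (subst₂ (Structure._≈_ (A * G)) p q) (subst₂ (Structure._≈_ (A * G)) (sym p) (sym q)))
      (definable-≈At (termLocation σ t) (termLocation σ u)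
        (λ ρ → proj₂ (pointAt-term ρ t)) (λ ρ → proj₂ (pointAt-term ρ u)))

    module _ (j : Fin k) where

      private
        inCopy : ∀ {j′} → Dec (j′ ≡ j) → Formula LA (baseVars σ)
        inCopy (yes _) = ⊤̇
        inCopy (no _)  = ¬̇ ⊤̇

        copyVar : ∀ {j′} → Dec (j′ ≡ j) → Fin (copyVars σ j′) → Term LG (copyVars σ j)
        copyVar (yes refl) y = var y
        -- A default term: `inCopy` is false in this case.
        copyVar (no _)     y = con z₀

      -- The point at l lies in the j-th copy: at its i-th root when it is a
      -- base vertex (for other points i plays no role).
      meets : Location σ → Fin r → Formula LA (baseVars σ)
      meets (inj₁ y)        i = var y ≐ var (tuple σ j i)
      meets (inj₂ (j′ , y)) i = inCopy (j′ ≟ j)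

      vertex : Location σ → Fin r → Term LG (copyVars σ j)
      vertex (inj₁ y)        i = con i
      vertex (inj₂ (j′ , y)) i = copyVar (j′ ≟ j) y

      module _ {A : BaseStructure L r ℓ} {G : Gadget L r ℓ} (ρ : Env A G σ) where

        private
          module A   = Structure A
          module G   = Gadget G
          module A*G = Structure (A * G)
          open Satisfaction

        MeetsAt : Location σ → Fin r → G.V → Set ℓ
        MeetsAt l i w = Sat A (baseEnv ρ) (meets l i)
                        × w G.≈ value G.structure (copyEnv ρ j) (vertex l i)

        meetsAt⇒≈ : ∀ l {w} → ∃[ i ] MeetsAt l i w → pointAt ρ l A*G.≈ inj₂ (copies ρ j , w)
        meetsAt⇒≈ (inj₁ y) (i , p , q) = ∼-root i (A.trans p (A.reflexive (baseEnv-tuple ρ j i))) q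
        meetsAt⇒≈ (inj₂ (j′ , y)) (i , p , q) with j′ ≟ j
        ... | yes refl = ∼-copy (λ _ → A.refl) (G.sym q)
        ... | no _     = contradiction (λ _ → A.refl) p

        ≈⇒meetsAt : ∀ l {w} → NonRootAt ρ l → pointAt ρ l A*G.≈ inj₂ (copies ρ j , w) → ∃[ i ] MeetsAt l i w
        ≈⇒meetsAt (inj₁ y) _ eq =
          let i , p , q = base-∼-copy eq
          in i , A.trans p (A.sym (A.reflexive (baseEnv-tuple ρ j i))) , q
        ≈⇒meetsAt (inj₂ (j′ , y)) nonRoot eq with copy-∼-copy nonRoot eq
        ... | e≈f , v≈w with j′ ≟ j
        -- Any index would do for a point that already lies in the copy.
        ... | yes refl = z₀ , (λ _ → A.refl) , G.sym v≈w
        ... | no j′≢j  = contradiction (copies-injective ρ j′ j e≈f) j′≢j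

        term-meets : ∀ t {w} → valueOf ρ t A*G.≈ inj₂ (copies ρ j , w) ⇔ (∃[ i ] MeetsAt (termLocation σ t) i w)
        term-meets t {w} = let eq , nonRoot = pointAt-term ρ t in mk⇔
          (≈⇒meetsAt (termLocation σ t) nonRoot ∘ subst (A*G._≈ inj₂ (copies ρ j , w)) (sym eq))
          (subst (A*G._≈ inj₂ (copies ρ j , w)) eq ∘ meetsAt⇒≈ (termLocation σ t))

      -- An argument in the copy is one of its non-root vertices or a base vertex glued to a root.
      -- An edge with repeated entries glues a base vertex to several roots, so the quantifier over
      -- `v` becomes a finite disjunction over all choices of roots.
      definable-inCopy : ∀ S (t : Vector (Term ⟦ L ⟧ n) (arity S)) →
        Definable (λ A G ρ → ∃[ v ] Gadget.⟦_⟧ᴿ G S v ×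
          (∀ l → Structure._≈_ (A * G) (valueOf ρ (t l)) (inj₂ (copies ρ j , v l))))
      definable-inCopy S t = definable-resp equivalence
        (definable-∃Fin (r ^ arity S) (λ N → definable-×
          (definable-base (α N)) (definable-copy j (atom S (γ N)))))
        where
        -- N enumerates the choices of a root for each argument.
        α : Fin (r ^ arity S) → Formula LA (baseVars σ)
        α N = ⋀̇ (λ l → meets (termLocation σ (t l)) (finToFun N l))

        γ : Fin (r ^ arity S) → Vector (Term LG (copyVars σ j)) (arity S)
        γ N l = vertex (termLocation σ (t l)) (finToFun N l)

        equivalence : ∀ {A G} (ρ : Env A G σ) →
          (∃[ N ] Satisfaction.Sat A (baseEnv ρ) (α N)
                  × Satisfaction.Sat (Gadget.structure G) (copyEnv ρ j) (atom S (γ N)))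
          ⇔ (∃[ v ] Gadget.⟦_⟧ᴿ G S v ×
              (∀ l → Structure._≈_ (A * G) (valueOf ρ (t l)) (inj₂ (copies ρ j , v l))))
        equivalence {A} {G} ρ = mk⇔
          (λ (N , p , q) → _ , q , λ l →
            from (term-meets ρ (t l)) (finToFun N l , to (Sat-⋀̇ A _) p l , Gadget.refl G))
          (λ (v , Sv , eq) →
            let choice : ∀ l → ∃[ i ] MeetsAt ρ (termLocation σ (t l)) i (v l)
                choice l = to (term-meets ρ (t l)) (eq l)
                N = funToFin (proj₁ ∘ choice)
                chosen : ∀ l → MeetsAt ρ (termLocation σ (t l)) (finToFun N l) (v l)
                chosen l = subst (λ i → MeetsAt ρ (termLocation σ (t l)) i (v l))
                  (sym (finToFun-funToFin (proj₁ ∘ choice) l)) (proj₂ (choice l))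
            in N , from (Sat-⋀̇ A _) (proj₁ ∘ chosen) , Gadget.⟦⟧ᴿ-respects G S (proj₂ ∘ chosen) Sv)

    private
      baseVar? : (l : Location σ) → Dec (∃[ y ] l ≡ inj₁ y)
      baseVar? (inj₁ y) = yes (y , refl)
      baseVar? (inj₂ _) = no λ ()

      ≈-base⇒baseVar : ∀ {A G} (ρ : Env A G σ) {a} l → NonRootAt ρ l →
                       Structure._≈_ (A * G) (pointAt ρ l) (inj₁ a) → ∃[ y ] l ≡ inj₁ y
      ≈-base⇒baseVar         ρ (inj₁ y) _       _  = y , refl
      ≈-base⇒baseVar {A} {G} ρ (inj₂ _) nonRoot eq =
        let i , _ , v≈z = base-∼-copy (Structure.sym (A * G) eq) in contradiction v≈z (nonRoot i)

    -- Non-root vertices of copies never equal base vertices, so every argument must have a base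
    -- location, and the shape decides whether this is so.
    definable-inBase : ∀ S (t : Vector (Term ⟦ L ⟧ n) (arity S)) →
      Definable (λ A G ρ → ∃[ a ] Structure.⟦_⟧ᴿ A (inj₁ S) a ×
        (∀ l → Structure._≈_ (A * G) (valueOf {σ = σ} ρ (t l)) (inj₁ (a l))))
    definable-inBase S t with all? (λ l → baseVar? (termLocation σ (t l)))
    ... | yes f = definable-resp equivalence (definable-base (atom (inj₁ S) (var ∘ y)))
      where
      y : Vector (Fin (baseVars σ)) (arity S)
      y = proj₁ ∘ f

      value-y : ∀ {A G} (ρ : Env A G σ) l → valueOf ρ (t l) ≡ inj₁ (baseEnv ρ (y l))
      value-y ρ l = trans (sym (proj₁ (pointAt-term ρ (t l)))) (cong (pointAt ρ) (proj₂ (f l)))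

      equivalence : ∀ {A G} (ρ : Env A G σ) →
        Satisfaction.Sat A (baseEnv ρ) (atom (inj₁ S) (var ∘ y))
        ⇔ (∃[ a ] Structure.⟦_⟧ᴿ A (inj₁ S) a ×
            (∀ l → Structure._≈_ (A * G) (valueOf ρ (t l)) (inj₁ (a l))))
      equivalence {A} {G} ρ = mk⇔
        (λ p → _ , p , λ l → Structure.reflexive (A * G) (value-y ρ l))
        (λ (a , p , eq) → Structure.⟦⟧ᴿ-respects A (inj₁ S)
          (λ l → Structure.sym A (base-∼-base
            (subst (λ x → Structure._≈_ (A * G) x (inj₁ (a l))) (value-y ρ l) (eq l)))) p)
    ... | no ¬f = definable-empty λ {A} {G} ρ (a , _ , eq) → ¬f λ l →
      let p , nonRoot = pointAt-term ρ (t l)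
      in ≈-base⇒baseVar ρ (termLocation σ (t l)) nonRoot
           (subst (λ x → Structure._≈_ (A * G) x (inj₁ (a l))) (sym p) (eq l))

  -- A tuple from the gadget may also come from a copy not met so far, whose roots are glued to the
  -- arguments; that copy is added and quantified away.
  definable-atom : {σ : Shape n k} → ∀ S (t : Vector (Term ⟦ L ⟧ n) (arity S)) →
                   Definable (λ A G ρ → Structure.⟦_⟧ᴿ (A * G) S (valueOf {σ = σ} ρ ∘ t))
  definable-atom {k = k} {σ = σ} S t = definable-resp equivalence
    (definable-⊎ (definable-inBase S t)
      (definable-⊎ (definable-∃Fin k (λ j → definable-inCopy j S t))
                   (definable-∃copy (definable-inCopy {σ = σ ▸copy} zero S t))))
    where
    InCopy : ∀ {A G} (ρ : Env A G σ) → Edge A → Set ℓ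
    InCopy {A} {G} ρ e = ∃[ v ] Gadget.⟦_⟧ᴿ G S v ×
      (∀ l → Structure._≈_ (A * G) (valueOf ρ (t l)) (inj₂ (e , v l)))

    equivalence : ∀ {A G} (ρ : Env A G σ) →
      ((∃[ a ] Structure.⟦_⟧ᴿ A (inj₁ S) a ×
          (∀ l → Structure._≈_ (A * G) (valueOf ρ (t l)) (inj₁ (a l))))
        ⊎ (∃[ j ] InCopy ρ (copies ρ j)) ⊎ (Σ[ e ∈ NewEdge ρ ] InCopy ρ (proj₁ e)))
      ⇔ Structure.⟦_⟧ᴿ (A * G) S (valueOf ρ ∘ t)
    equivalence {A} {G} ρ = mk⇔
      (λ { (inj₁ p) → inj₁ p ; (inj₂ (inj₁ (j , p))) → inj₂ (_ , p) ; (inj₂ (inj₂ (e , p))) → inj₂ (_ , p) })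
      (λ { (inj₁ p) → inj₁ p ; (inj₂ (e , p)) → inj₂ (place e p (isCopy? ρ e)) })
      where
      place : ∀ e → InCopy ρ e → (∃[ j ] EqualEdges A e (copies ρ j)) ⊎ (∀ j → ¬ EqualEdges A e (copies ρ j)) →
              (∃[ j ] InCopy ρ (copies ρ j)) ⊎ (Σ[ e ∈ NewEdge ρ ] InCopy ρ (proj₁ e))
      place e (v , Sv , eq) (inj₁ (j , e≈)) =
        inj₁ (j , v , Sv , λ l → Structure.trans (A * G) (eq l) (∼-copy e≈ (Gadget.refl G)))
      place e p             (inj₂ e-new)    = inj₂ ((e , e-new) , p)

  -- Quantifiers over A * G and arbitrary formulas.

  module _ (φ : Formula ⟦ L ⟧ (suc n))
           (definable-φ : ∀ {k} (σ : Shape (suc n) k) →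
                          Definable (λ A G ρ → Satisfaction.Sat (A * G) (points {σ = σ} ρ) φ))
           where

    -- Each kind of new point extends `σ` differently, hence the assumption on `φ` for all shapes.
    definable-∃̇ : (σ : Shape n k) →
                  Definable (λ A G ρ → Satisfaction.Sat (A * G) (points {σ = σ} ρ) (∃̇ φ))
    definable-∃̇ {k = k} σ = definable-resp equivalence
      (definable-⊎ (definable-∃base (definable-φ (σ ▸base)))
        (definable-⊎ (definable-∃Fin k (λ j → definable-∃gadget j (definable-φ (σ ▸gadget j))))
                     (definable-∃copy (definable-∃gadget zero (definable-φ (σ ▸copy ▸gadget zero))))))
      where
      module _ {A : BaseStructure L r ℓ} {G : Gadget L r ℓ} (ρ : Env A G σ) where

        open Satisfaction (A * G)

        Cases : Set ℓ
        Cases = (∃[ a ] Sat (points (base ρ a)) φ)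
              ⊎ (∃[ j ] ∃[ v ] Sat (points (gadget ρ j v)) φ)
              ⊎ (∃[ e ] ∃[ v ] Sat (points (gadget (copy ρ e) zero v)) φ)

        move : ∀ {x y} → Structure._≈_ (A * G) x y → Sat (x ∷ points ρ) φ → Sat (y ∷ points ρ) φ
        move x≈y = Sat-cong (A * G) (λ { zero → x≈y ; (suc l) → Structure.refl (A * G) }) φ

        classify : ∀ x → Sat (x ∷ points ρ) φ → Cases
        classify (inj₁ a)       p = inj₁ (a , p)
        classify (inj₂ (e , v)) p with em {∃[ i ] Gadget._≈_ G v (Gadget.root G i)}
        -- A root is counted as the base vertex to which it is glued.
        ... | yes (i , v≈z) = inj₁ (proj₁ e i ,
          move (Structure.sym (A * G) (∼-root i (Structure.refl A) v≈z)) p)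
        ... | no nonRoot with isCopy? ρ e
        ... | inj₁ (j , e≈) = inj₂ (inj₁ (j , (v , λ i q → nonRoot (i , q)) , move (∼-copy e≈ (Gadget.refl G)) p))
        ... | inj₂ e-new    = inj₂ (inj₂ ((e , e-new) , (v , λ i q → nonRoot (i , q)) , p))

        equivalence : Cases ⇔ Sat (points ρ) (∃̇ φ)
        equivalence = mk⇔
          (λ where
            (inj₁ (a , p))            → inj₁ a , p
            (inj₂ (inj₁ (j , v , p))) → inj₂ (copies ρ j , proj₁ v) , p
            (inj₂ (inj₂ (e , v , p))) → inj₂ (proj₁ e , proj₁ v) , p)
          (λ (x , p) → classify x p)

  definable-Sat : (φ : Formula ⟦ L ⟧ n) (σ : Shape n k) →
                  Definable (λ A G ρ → Satisfaction.Sat (A * G) (points {σ = σ} ρ) φ)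
  definable-Sat (t ≐ u)    σ = definable-≐ t u
  definable-Sat (atom S t) σ = definable-atom S t
  definable-Sat (¬̇ φ)      σ = definable-¬ (definable-Sat φ σ)
  definable-Sat (φ ∧̇ ψ)    σ = definable-× (definable-Sat φ σ) (definable-Sat ψ σ)
  definable-Sat (φ ∨̇ ψ)    σ = definable-⊎ (definable-Sat φ σ) (definable-Sat ψ σ)
  definable-Sat (φ ⇒̇ ψ)    σ = definable-→ (definable-Sat φ σ) (definable-Sat ψ σ)
  definable-Sat (∃̇ φ)      σ = definable-∃̇ φ (definable-Sat φ) σ
  -- Treated classically as the negation of an existential.
  definable-Sat (∀̇ φ)      σ = definable-resp
    (λ {A} {G} ρ → mk⇔
      (λ none a → decidable-stable em (λ ¬p → none (a , ¬p)))
      (λ p (a , ¬p) → ¬p (p a)))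
    (definable-¬ (definable-∃̇ (¬̇ φ) (λ σ → definable-¬ (definable-Sat φ σ)) σ))

-- Eventual truth along the sequences and truth in the limits.

Eventually-map : {P : ℕ → Set p} {Q : ℕ → Set q} → (∀ n → P n → Q n) → Eventually P → Eventually Q
Eventually-map f (N , p) = N , λ n N≤n → f n (p n N≤n)

Eventually-× : {P : ℕ → Set p} {Q : ℕ → Set q} → Eventually P → Eventually Q →
               Eventually (λ n → P n × Q n)
Eventually-× (N , p) (M , q) = N ⊔ M , λ n N⊔M≤n →
  p n (≤-trans (m≤m⊔n N M) N⊔M≤n) , q n (≤-trans (m≤n⊔m N M) N⊔M≤n)

Eventually-contradiction : {P : ℕ → Set p} → Eventually P → ¬ Eventually (λ n → ¬ P n)
Eventually-contradiction p ¬p = let N , f = Eventually-× p ¬p in proj₂ (f N ≤-refl) (proj₁ (f N ≤-refl))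

module _ {ℓ} (em : ExcludedMiddle ℓ) {s} (L : RelationalLanguage s) (r : ℕ) {{_ : NonZero r}}
         (A : ℕ → BaseStructure L r ℓ) (G : ℕ → Gadget L r ℓ) where

  private
    Sequence : Clause em L r ε → ℕ → Set ℓ
    Sequence c n = _⊩_ em L r {A = A n} {G n} ε c

  -- With no copies a clause is a sentence of A and a sentence of G, both eventually decided by
  -- convergence; finite conjunctions and disjunctions preserve this.
  definable-convergent : {P : Predicate em L r p ε} → Definable em L r P →
                         ElementarilyConvergent A → ElementarilyConvergent (Gadget.structure ∘ G) →
                         Eventually (λ n → P (A n) (G n) ε) ⊎ Eventually (λ n → ¬ P (A n) (G n) ε)
  definable-convergent (definable d d⇔P) convA convG = Sum.map
    (Eventually-map (λ n → to (d⇔P ε)))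
    (Eventually-map (λ n → _∘ from (d⇔P ε)))
    (decide d)
    where
    decide-clause : ∀ c → Eventually (Sequence c) ⊎ Eventually (λ n → ¬ Sequence c n)
    decide-clause c with convA (Clause.onBase c) | convG (Clause.onGadget c)
    ... | inj₂ ¬α | _      = inj₂ (Eventually-map (λ n ¬α (α , _) → ¬α α) ¬α)
    ... | inj₁ α  | inj₂ ¬γ = inj₂ (Eventually-map (λ n ¬γ (_ , _ , γ) → ¬γ γ) ¬γ)
    ... | inj₁ α  | inj₁ γ = inj₁ (Eventually-map (λ n (α , γ) → α , (λ ()) , γ) (Eventually-× α γ))

    decide : ∀ d → Eventually (λ n → Any (λ c → Sequence c n) d)
                   ⊎ Eventually (λ n → ¬ Any (λ c → Sequence c n) d)
    decide List.[]      = inj₂ (0 , λ _ _ ())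
    decide (c List.∷ d) with decide-clause c | decide d
    ... | inj₁ p  | _       = inj₁ (Eventually-map (λ n → here) p)
    ... | inj₂ ¬p | inj₁ q  = inj₁ (Eventually-map (λ n → there) q)
    ... | inj₂ ¬p | inj₂ ¬q = inj₂ (Eventually-map
      (λ { n (¬p , ¬q) (here p) → ¬p p ; n (¬p , ¬q) (there q) → ¬q q }) (Eventually-× ¬p ¬q))

  -- Both sentences of a true clause pass from the limits to almost all members. The converse
  -- direction comes from applying this to a negation.
  definable-limit : {P : Predicate em L r p ε} → Definable em L r P →
                    ∀ A∞ G∞ → IsElementaryLimit A∞ A →
                    IsElementaryLimit (Gadget.structure G∞) (Gadget.structure ∘ G) →
                    P A∞ G∞ ε → Eventually (λ n → P (A n) (G n) ε)
  definable-limit (definable d d⇔P) A∞ G∞ limA limG =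
    Eventually-map (λ n → to (d⇔P ε)) ∘ inherit d ∘ from (d⇔P ε)
    where
    inherit : ∀ d → Any (_⊩_ em L r {A = A∞} {G∞} ε) d → Eventually (λ n → Any (λ c → Sequence c n) d)
    inherit (c List.∷ d) (here (α , _ , γ)) = Eventually-map (λ n (α , γ) → here (α , (λ ()) , γ))
      (Eventually-× (to (limA (Clause.onBase c)) α) (to (limG (Clause.onGadget c)) γ))
    inherit (c List.∷ d) (there q)          = Eventually-map (λ n → there) (inherit d q)

corollary3p2 : ∀ {s ℓ} → ExcludedMiddle ℓ →
    (L : RelationalLanguage s) (r : ℕ) {{_ : NonZero r}}
    (A : ℕ → BaseStructure L r ℓ) (G : ℕ → Gadget L r ℓ) →
    ElementarilyConvergent A →
    ElementarilyConvergent (Gadget.structure ∘ G) →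
    ElementarilyConvergent (λ n → A n * G n)
    × (∀ (A∞ : BaseStructure L r ℓ) (G∞ : Structure (L +constants r) ℓ) (M∞ : Structure ⟦ L ⟧ ℓ) →
    IsElementaryLimit A∞ A →
    (limG : IsElementaryLimit G∞ (Gadget.structure ∘ G)) →
    IsElementaryLimit M∞ (λ n → A n * G n) →
    M∞ ≡ₑ A∞ * limitGadget G G∞ limG)
corollary3p2 em L r A G convA convG =
  (λ φ → definable-convergent em L r A G (definable-Sat em L r φ ε) convA convG) ,
  λ A∞ G∞ M∞ limA limG limM φ →
    let limit : ∀ ψ → A∞ * limitGadget G G∞ limG ⊨ ψ → Eventually (λ n → A n * G n ⊨ ψ)
        limit ψ = definable-limit em L r A G (definable-Sat em L r ψ ε) A∞ (limitGadget G G∞ limG) limA limG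
    in mk⇔
      -- If `φ` failed in the product of the limits, `limit` for `¬̇ φ` would make `φ` eventually
      -- false, whereas `M∞` makes it eventually true.
      (λ p → decidable-stable em (λ ¬q → Eventually-contradiction (to (limM φ) p) (limit (¬̇ φ) ¬q)))
      (from (limM φ) ∘ limit φ)
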